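{- There exists a constant $c>0$ such that for every integer $n\geq 1$ and every integer $N\geq 2^{cn^{4}(\log_2 n)^2}$, every $8n^2\times N$ real matrix contains an $n\times n$ row-monotone submatrix.
   Context: An $n\times n$ submatrix of a real matrix $A$ is obtained by choosing row indices $i_1<\dots<i_n$ and column indices $j_1<\dots<j_n$ and taking $B(k,l)=A(i_k,j_l)$. A matrix is row-monotone if either every row is monotone increasing (non-decreasing) or every row is monotone decreasing (non-increasing). -}

module Defs where

open import Level using (Level)
open import Data.Nat using (ℕ; _*_)
open import Data.Fin using (Fin) renaming (_<_ to _<ᶠ_; _≤_ to _≤ᶠ_)
open import Data.Product using (Σ; _×_)
open import Data.Sum using (_⊎_)
open import Relation.Binary.Bundles using (TotalOrder)

Matrix : ∀ {a} → Set a → ℕ → ℕ → Set a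
Matrix A m k = Fin m → Fin k → A

StrictlyIncreasing : ∀ {m k} → (Fin m → Fin k) → Set
StrictlyIncreasing f = ∀ i j → i <ᶠ j → f i <ᶠ f j

submatrix : ∀ {a} {A : Set a} {m k n} → Matrix A m k →
            (Fin n → Fin m) → (Fin n → Fin k) → Matrix A n n
submatrix A f g r c = A (f r) (g c)

module _ {a ℓ₁ ℓ₂} (O : TotalOrder a ℓ₁ ℓ₂) where
  open TotalOrder O renaming (Carrier to C)

  RowsIncreasing : ∀ {m k} → Matrix C m k → Set ℓ₂
  RowsIncreasing B = ∀ r l l' → l ≤ᶠ l' → B r l ≤ B r l'

  RowsDecreasing : ∀ {m k} → Matrix C m k → Set ℓ₂
  RowsDecreasing B = ∀ r l l' → l ≤ᶠ l' → B r l' ≤ B r l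

  RowMonotone : ∀ {m k} → Matrix C m k → Set ℓ₂
  RowMonotone B = RowsIncreasing B ⊎ RowsDecreasing B

  HasRowMonotoneSubmatrix : ∀ {m k} → ℕ → Matrix C m k → Set ℓ₂
  HasRowMonotoneSubmatrix {m} {k} n A =
    Σ (Fin n → Fin m) λ f → Σ (Fin n → Fin k) λ g →
      StrictlyIncreasing f × StrictlyIncreasing g × RowMonotone (submatrix A f g)

{-# OPTIONS --safe #-}
module Submission where

-- Columns are halved by index and then, row by row, both halves are halved again so that the row
-- compares all of the left part with all of the right part in one direction.  Iterating gives a
-- complete binary tree of columns, each node coloured by the vector of m = 8n² signs that relates
-- the leaves on its left to those on its right.  A count in the style of the Sauer–Shelah lemma
-- shows that in depth O(mt) the tree contains an embedded complete binary tree of depth t in which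
-- each level has a constant colour.  For t of order (log n)², double counting yields
-- L = ⌈log₂ n⌉ of the t levels and n rows with one sign on all of these levels, and the
-- 2 ^ L ≥ n leaves of the corresponding subtree are the columns sought.

open import Defs
open import Level using (0ℓ)
open import Data.Bool using (Bool; true; false; T; _∧_; _∨_; if_then_else_)
open import Data.Fin as Fin using (Fin; zero; suc; funToFin; finToFun)
open import Data.Fin.Properties as Finₚ using (finToFun-funToFin)
open import Data.List using (List; []; _∷_; _++_; length; map; take; drop; filter; allFin; lookup)
open import Data.List.Properties using (length-take; length-drop; take++drop≡id; length-++; length-tabulate)
open import Data.List.Membership.Propositional using (_∈_; find)
open import Data.List.Membership.Propositional.Properties using (∈-++⁺ˡ; ∈-++⁺ʳ; ∈-++⁻; ∈-lookup)
open import Data.List.Relation.Binary.Permutation.Propositional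
  using (_↭_; ↭-refl; ↭-sym; ↭-trans; ↭-prep; ↭-swap; ↭⇒↭ₛ)
open import Data.List.Relation.Binary.Permutation.Propositional.Properties using (∈-resp-↭; All-resp-↭; ↭-length)
import Data.List.Relation.Binary.Permutation.Setoid.Properties as Permutationₛ
open import Data.List.Relation.Binary.Sublist.Propositional
  using ([]; _∷_; _∷ʳ_; ⊆-refl; ⊆-trans; minimum) renaming (_⊆_ to _⊑_)
open import Data.List.Relation.Binary.Sublist.Propositional.Properties using (All-resp-⊆; filter-⊆)
open import Data.List.Relation.Binary.Subset.Propositional using (_⊆_)
open import Data.List.Relation.Unary.All as All using (All; []; _∷_)
import Data.List.Relation.Unary.All.Properties as Allₚ
open import Data.List.Relation.Unary.AllPairs using (AllPairs; []; _∷_)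
import Data.List.Relation.Unary.AllPairs.Properties as AllPairsₚ
open import Data.List.Relation.Unary.Any using (here; there)
open import Data.List.Relation.Unary.Unique.Propositional using (Unique)
import Data.List.Relation.Unary.Unique.Propositional.Properties as Uniqueₚ
open import Data.Nat
  using (ℕ; zero; suc; _+_; _*_; _^_; _∸_; _⊓_; ⌊_/2⌋; ⌈_/2⌉; _≤_; _≥_; _<_; z≤n; s≤s; NonZero; >-nonZero)
open import Data.Nat.Combinatorics using (_C_; nCk+nC[k+1]≡[n+1]C[k+1]; nCn≡1)
open import Data.Nat.ListAction renaming (sum to sumᴸ)
open import Data.Nat.Logarithm using (⌈log₂_⌉; ⌈log₂⌉-mono-≤; ⌈log₂2^n⌉≡n)
open import Data.Nat.Logarithm.Core using (⌈log2⌉)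
open import Data.Nat.Properties
open import Algebra.Properties.Semiring.Sum +-*-semiring
  using (sum; sum-cong-≗; ∑-distrib-+; *-distribˡ-sum)
open import Data.Nat.Tactic.RingSolver using (solve-∀)
open import Data.Product using (Σ; ∃; ∃₂; _×_; _,_; proj₁; proj₂)
open import Data.Sum as Sum using (_⊎_; inj₁; inj₂)
open import Data.Vec using (Vec; []; _∷_)
open import Function using (_∘_; id)
open import Induction.WellFounded using (acc)
open import Relation.Binary.Bundles using (TotalOrder)
open import Relation.Binary.PropositionalEquality
open import Relation.Nullary using (Dec; yes; no; does; contradiction)
open import Relation.Nullary.Decidable using (⌊_⌋; toWitness)

private variable
  A B : Set

-- Sorting and halving lists.

Separated : (A → A → Set) → List A → List A → Set
Separated R xs ys = ∀ {x y} → x ∈ xs → y ∈ ys → R x y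

separated-⊎ : {P Q : A → A → Set} → (∀ x y → P x y ⊎ Q x y) → ∀ xs ys →
              Separated P xs ys ⊎ ∃₂ λ x y → x ∈ xs × y ∈ ys × Q x y
separated-⊎ P∪Q xs ys with All.decide (λ x → All.decide (P∪Q x) ys) xs
... | inj₁ ps = inj₁ λ x∈xs y∈ys → All.lookup (All.lookup ps x∈xs) y∈ys
... | inj₂ q with find q
...   | x , x∈xs , q′ with find q′
...     | y , y∈ys , Qxy = inj₂ (x , y , x∈xs , y∈ys , Qxy)

-- Uniqueness is carried as an implication, so that restrictions compose without a standing
-- hypothesis; `build` uses it to make the order of columns strict.
_≼_ : List A → List A → Set
xs ≼ ys = xs ⊆ ys × (Unique ys → Unique xs)

≼-refl : {xs : List A} → xs ≼ xs
≼-refl = id , id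

≼-trans : {xs ys zs : List A} → xs ≼ ys → ys ≼ zs → xs ≼ zs
≼-trans (s , u) (s′ , u′) = s′ ∘ s , u ∘ u′

AllPairs-++⁻ : {R : A → A → Set} (xs {ys} : List A) → AllPairs R (xs ++ ys) → Separated R xs ys
AllPairs-++⁻ (x ∷ xs) (px ∷ _)   (here refl)  y∈ys = All.lookup px (∈-++⁺ʳ xs y∈ys)
AllPairs-++⁻ (x ∷ xs) (_  ∷ pxs) (there x∈xs) y∈ys = AllPairs-++⁻ xs pxs x∈xs y∈ys

Unique-resp-↭ : {xs ys : List A} → xs ↭ ys → Unique xs → Unique ys
Unique-resp-↭ {A = A} p = Permutationₛ.Unique-resp-↭ (setoid A) (↭⇒↭ₛ p)

module _ {R : A → A → Set} (total : ∀ x y → R x y ⊎ R y x)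
         (R-trans : ∀ {x y z} → R x y → R y z → R x z) where

  insert : ∀ x ys → AllPairs R ys → ∃ λ zs → zs ↭ x ∷ ys × AllPairs R zs
  insert x []       []         = x ∷ [] , ↭-refl , [] ∷ []
  insert x (y ∷ ys) (py ∷ pys) with total x y
  ... | inj₁ x≤y = x ∷ y ∷ ys , ↭-refl , (x≤y ∷ All.map (R-trans x≤y) py) ∷ py ∷ pys
  ... | inj₂ y≤x with insert x ys pys
  ...   | zs , zs↭ , pzs = y ∷ zs , ↭-trans (↭-prep y zs↭) (↭-swap y x ↭-refl)
                         , All-resp-↭ (↭-sym zs↭) (y≤x ∷ py) ∷ pzs

  sort : ∀ xs → ∃ λ ys → ys ↭ xs × AllPairs R ys
  sort []       = [] , ↭-refl , []
  sort (x ∷ xs) with sort xs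
  ... | ys , ys↭ , pys with insert x ys pys
  ...   | zs , zs↭ , pzs = zs , ↭-trans zs↭ (↭-prep x ys↭) , pzs

  -- Sort, then cut in the middle. This serves two orders: the column index in `build`, and the
  -- entries of a single row in `comparable-halves`.
  halve : ∀ k xs → length xs ≡ k + k → ∃₂ λ lo hi →
          lo ≼ xs × hi ≼ xs × length lo ≡ k × length hi ≡ k ×
          Separated R lo hi × (Unique xs → Separated _≢_ lo hi)
  halve k xs len with sort xs
  ... | ys , ys↭ , pys =
    take k ys , drop k ys ,
    (∈-resp-↭ ys↭ ∘ subst (_ ∈_) ++≡ ∘ ∈-++⁺ˡ , Uniqueₚ.take⁺ k ∘ unique) ,
    (∈-resp-↭ ys↭ ∘ subst (_ ∈_) ++≡ ∘ ∈-++⁺ʳ (take k ys) , Uniqueₚ.drop⁺ k ∘ unique) ,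
    trans (length-take k ys) (trans (cong (_ ⊓_) len′) (m≤n⇒m⊓n≡m (m≤m+n k k))) ,
    trans (length-drop k ys) (trans (cong (_∸ k) len′) (m+n∸n≡m k k)) ,
    AllPairs-++⁻ (take k ys) (subst (AllPairs R) (sym ++≡) pys) ,
    λ u → AllPairs-++⁻ (take k ys) (subst Unique (sym ++≡) (unique u))
    where
    ++≡ : take k ys ++ drop k ys ≡ ys
    ++≡ = take++drop≡id k ys
    unique : Unique xs → Unique ys
    unique = Unique-resp-↭ (↭-sym ys↭)
    len′ : length ys ≡ k + k
    len′ = trans (↭-length ys↭) len

  -- If some element of the lower half of xs exceeds some element of the upper half of ys,
  -- then the whole upper half of xs lies above the whole lower half of ys.
  comparable-halves : ∀ k xs ys → length xs ≡ k + k → length ys ≡ k + k →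
    ∃₂ λ xs′ ys′ → xs′ ≼ xs × ys′ ≼ ys × length xs′ ≡ k × length ys′ ≡ k ×
    (Separated R xs′ ys′ ⊎ Separated (λ x y → R y x) xs′ ys′)
  comparable-halves k xs ys lx ly with halve k xs lx | halve k ys ly
  ... | lx , hx , lx≼ , hx≼ , |lx| , |hx| , lx≤hx , _
      | ly , hy , ly≼ , hy≼ , |ly| , |hy| , ly≤hy , _
      with separated-⊎ total lx hy
  ... | inj₁ lx≤hy = lx , hy , lx≼ , hy≼ , |lx| , |hy| , inj₁ lx≤hy
  ... | inj₂ (x , y , x∈ , y∈ , y≤x) = hx , ly , hx≼ , ly≼ , |hx| , |ly| ,
        inj₂ λ x′∈ y′∈ → R-trans (ly≤hy y′∈ y∈) (R-trans y≤x (lx≤hx x∈ x′∈))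

-- Sign vectors and the tree of columns.

module _ (O : TotalOrder 0ℓ 0ℓ 0ℓ) where
  open TotalOrder O using (total) renaming (Carrier to V; _≤_ to _≤ᴼ_; trans to ≤ᴼ-trans)

  Signed : Fin 2 → V → V → Set
  Signed zero    u v = u ≤ᴼ v
  Signed (suc _) u v = v ≤ᴼ u

  -- Each row in turn halves both lists by `comparable-halves`, whence the factor `2 ^ m`. A sign
  -- once fixed survives because `Separated` passes to smaller lists.
  constant-signs : ∀ m (K : Fin m → B → V) k xs ys →
    length xs ≡ 2 ^ m * k → length ys ≡ 2 ^ m * k →
    ∃₂ λ xs′ ys′ → xs′ ≼ xs × ys′ ≼ ys × length xs′ ≡ k × length ys′ ≡ k ×
    Σ (Fin m → Fin 2) λ s → ∀ r → Separated (λ x y → Signed (s r) (K r x) (K r y)) xs′ ys′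
  constant-signs zero K k xs ys lx ly =
    xs , ys , ≼-refl , ≼-refl , trans lx (+-identityʳ k) , trans ly (+-identityʳ k) , (λ ()) , λ ()
  constant-signs (suc m) K k xs ys lx ly
    with comparable-halves {R = λ x y → K zero x ≤ᴼ K zero y} (λ x y → total _ _) ≤ᴼ-trans
           (2 ^ m * k) xs ys (trans lx (double (2 ^ m) k)) (trans ly (double (2 ^ m) k))
    where
    double : ∀ a k → 2 * a * k ≡ a * k + a * k
    double = solve-∀
  ... | xs₁ , ys₁ , xs₁≼ , ys₁≼ , lx₁ , ly₁ , sep
    with constant-signs m (K ∘ suc) k xs₁ ys₁ lx₁ ly₁
  ... | xs₂ , ys₂ , xs₂≼ , ys₂≼ , lx₂ , ly₂ , s , seps =
    xs₂ , ys₂ , ≼-trans xs₂≼ xs₁≼ , ≼-trans ys₂≼ ys₁≼ , lx₂ , ly₂ , extend sep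
    where
    extend : _ → _
    extend (inj₁ le) = (λ { zero → zero ; (suc r) → s r }) ,
      λ { zero x∈ y∈ → le (proj₁ xs₂≼ x∈) (proj₁ ys₂≼ y∈) ; (suc r) → seps r }
    extend (inj₂ ge) = (λ { zero → suc zero ; (suc r) → s r }) ,
      λ { zero x∈ y∈ → ge (proj₁ xs₂≼ x∈) (proj₁ ys₂≼ y∈) ; (suc r) → seps r }

-- Separation relates the whole lists `ys` and `zs`, so a colour governs every pair of leaves that
-- its node splits. Inclusions in `xs`, instead of a partition, leave room for discarded columns.
data Tree {q : ℕ} (R : Fin q → A → A → Set) : ℕ → List A → Set where
  leaf : ∀ {xs} x → x ∈ xs → Tree R 0 xs
  node : ∀ {D xs ys zs} c → Separated (R c) ys zs → ys ⊆ xs → zs ⊆ xs →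
         Tree R D ys → Tree R D zs → Tree R (suc D) xs

module _ (O : TotalOrder 0ℓ 0ℓ 0ℓ) {m N : ℕ} (M : Matrix (TotalOrder.Carrier O) m N) where

  -- The colour c encodes one sign per row.
  Pattern : Fin (2 ^ m) → Fin N → Fin N → Set
  Pattern c x y = x Fin.< y × (∀ r → Signed O (finToFun c r) (M r x) (M r y))

  -- A level costs the factor `2 * 2 ^ m`: one halving by column index, which puts left columns
  -- before right ones, and one halving per row for the signs.
  build : ∀ D xs → Unique xs → length xs ≡ (2 * 2 ^ m) ^ D → Tree Pattern D xs
  build zero    (x ∷ _) _ _ = leaf x (here refl)
  build (suc D) xs u len
    with halve {R = Fin._≤_} Finₚ.≤-total Finₚ.≤-trans (2 ^ m * (2 * 2 ^ m) ^ D) xs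
           (trans len (double (2 ^ m) _))
    where
    double : ∀ a k → 2 * a * k ≡ a * k + a * k
    double = solve-∀
  ... | lo , hi , lo≼ , hi≼ , |lo| , |hi| , lo≤hi , lo≢hi
    with constant-signs O m M ((2 * 2 ^ m) ^ D) lo hi |lo| |hi|
  ... | ys , zs , ys≼ , zs≼ , |ys| , |zs| , s , sep =
    node (funToFin s) pat (proj₁ ys≼xs) (proj₁ zs≼xs)
      (build D ys (proj₂ ys≼xs u) |ys|) (build D zs (proj₂ zs≼xs u) |zs|)
    where
    ys≼xs : ys ≼ xs
    ys≼xs = ≼-trans ys≼ lo≼
    zs≼xs : zs ≼ xs
    zs≼xs = ≼-trans zs≼ hi≼
    pat : Separated (Pattern (funToFin s)) ys zs
    pat x∈ y∈ = Finₚ.≤∧≢⇒< (lo≤hi (proj₁ ys≼ x∈) (proj₁ zs≼ y∈)) (lo≢hi u (proj₁ ys≼ x∈) (proj₁ zs≼ y∈)) ,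
      λ r → subst (λ σ → Signed O σ _ _) (sym (finToFun-funToFin s r)) (sep r x∈ y∈)

  complete-tree : ∀ D → 2 ^ (suc m * D) ≤ N → ∃ λ xs → Tree Pattern D xs
  complete-tree D 2^≤N = take P (allFin N) , build D _ (Uniqueₚ.take⁺ P (Uniqueₚ.allFin⁺ N))
    (trans (length-take P (allFin N)) (m≤n⇒m⊓n≡m (≤-trans P≤N (≤-reflexive (sym (length-tabulate id))))))
    where
    P = (2 * 2 ^ m) ^ D
    P≤N : P ≤ N
    P≤N = ≤-trans (≤-reflexive (^-*-assoc 2 (suc m) D)) 2^≤N

-- Sums over words and the Sauer-Shelah count.

sum-pigeonhole : ∀ {n} (f g : Fin n → ℕ) → sum g < sum f → ∃ λ i → g i < f i
sum-pigeonhole {suc n} f g Σ< with g zero <? f zero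
... | yes g<f = zero , g<f
... | no  g≮f with sum-pigeonhole (f ∘ suc) (g ∘ suc)
                     (+-cancelˡ-< (f zero) _ _ (≤-<-trans (+-monoˡ-≤ _ (≮⇒≥ g≮f)) Σ<))
...   | i , g<f = suc i , g<f

sum-const : ∀ n k → sum {n} (λ _ → k) ≡ n * k
sum-const zero    k = refl
sum-const (suc n) k = cong (k +_) (sum-const n k)

term≤sum : ∀ {n} (f : Fin n → ℕ) i → f i ≤ sum f
term≤sum f zero    = m≤m+n _ _
term≤sum f (suc i) = ≤-trans (term≤sum (f ∘ suc) i) (m≤n+m _ _)

-- A letter zero skips a level of the tree, a letter suc c demands branching at a level coloured c.
Word : ℕ → ℕ → Set
Word q D = Vec (Fin (suc q)) D

letters : ∀ {q D} → Word q D → List (Fin q)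
letters []          = []
letters (zero  ∷ w) = letters w
letters (suc c ∷ w) = c ∷ letters w

sumWords : ∀ {q} D → (Word q D → ℕ) → ℕ
sumWords zero    F = F []
sumWords (suc D) F = sum λ x → sumWords D (F ∘ (x ∷_))

sumWords-pigeonhole : ∀ {q} D (F G : Word q D → ℕ) →
                      sumWords D G < sumWords D F → ∃ λ w → G w < F w
sumWords-pigeonhole zero    F G Σ< = [] , Σ<
sumWords-pigeonhole (suc D) F G Σ< with sum-pigeonhole (λ x → sumWords D (F ∘ (x ∷_))) _ Σ<
... | x , Σ<′ with sumWords-pigeonhole D (F ∘ (x ∷_)) (G ∘ (x ∷_)) Σ<′
...   | w , G<F = x ∷ w , G<F

sumWords-cong : ∀ {q} D {F G : Word q D → ℕ} → F ≗ G → sumWords D F ≡ sumWords D G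
sumWords-cong zero    F≗G = F≗G []
sumWords-cong (suc D) F≗G = sum-cong-≗ λ x → sumWords-cong D (F≗G ∘ (x ∷_))

sumWords-+ : ∀ {q} D (F G : Word q D → ℕ) →
             sumWords D (λ w → F w + G w) ≡ sumWords D F + sumWords D G
sumWords-+ zero    F G = refl
sumWords-+ (suc D) F G = trans
  (sum-cong-≗ λ x → sumWords-+ D (F ∘ (x ∷_)) (G ∘ (x ∷_)))
  (∑-distrib-+ (λ x → sumWords D (F ∘ (x ∷_))) (λ x → sumWords D (G ∘ (x ∷_))))

sumWords-* : ∀ {q} D k (F : Word q D → ℕ) → sumWords D (λ w → k * F w) ≡ k * sumWords D F
sumWords-* zero    k F = refl
sumWords-* (suc D) k F = trans
  (sum-cong-≗ λ x → sumWords-* D k (F ∘ (x ∷_)))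
  (sym (*-distribˡ-sum k λ x → sumWords D (F ∘ (x ∷_))))

indicator : Bool → ℕ
indicator b = if b then 1 else 0

indicator-∨-∧ : ∀ x y → indicator x + indicator y ≡ indicator (x ∨ y) + indicator (x ∧ y)
indicator-∨-∧ true  true  = refl
indicator-∨-∧ true  false = refl
indicator-∨-∧ false true  = refl
indicator-∨-∧ false false = refl

module _ {q : ℕ} {R : Fin q → A → A → Set} where

  -- A realised word witnesses an embedded complete binary tree that branches at the depths of the
  -- letters. Both children must realise the same `w`, which forces one colour per branching level.
  realises : ∀ {D xs} → Tree R D xs → Word q D → Bool
  realises (leaf _ _)         []          = true
  realises (node c _ _ _ l r) (zero  ∷ w) = realises l w ∨ realises r w
  realises (node c _ _ _ l r) (suc d ∷ w) = ⌊ c Finₚ.≟ d ⌋ ∧ (realises l w ∧ realises r w)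

  -- As in the order-shattering proof of the Sauer–Shelah lemma: a word realised by both subtrees
  -- of a node extends in two ways, a word realised by one of them in at least one.
  realised-words : ∀ {D xs} (t : Tree R D xs) → 2 ^ D ≤ sumWords D (indicator ∘ realises t)
  realised-words (leaf _ _) = ≤-refl
  realised-words {suc D} t@(node c _ _ _ l r) = begin
    2 ^ D + (2 ^ D + 0)                         ≡⟨ cong (2 ^ D +_) (+-identityʳ _) ⟩
    2 ^ D + 2 ^ D                               ≤⟨ +-mono-≤ (realised-words l) (realised-words r) ⟩
    sumWords D (indicator ∘ realises l) + sumWords D (indicator ∘ realises r)
      ≡⟨ sumWords-+ D _ _ ⟨
    sumWords D (λ w → indicator (realises l w) + indicator (realises r w))
      ≡⟨ sumWords-cong D (λ w → indicator-∨-∧ (realises l w) (realises r w)) ⟩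
    sumWords D (λ w → indicator (realises l w ∨ realises r w) + indicator (realises l w ∧ realises r w))
      ≡⟨ sumWords-+ D _ _ ⟩
    either + sumWords D (λ w → indicator (realises l w ∧ realises r w))
      ≡⟨ cong (either +_) (sumWords-cong D λ w →
           cong (λ b → indicator (b ∧ (realises l w ∧ realises r w))) (sym c≟c)) ⟩
    either + branching c
      ≤⟨ +-monoʳ-≤ either (term≤sum branching c) ⟩
    either + sum branching ∎
    where
    open ≤-Reasoning
    either = sumWords D (λ w → indicator (realises l w ∨ realises r w))
    branching : Fin q → ℕ
    branching d = sumWords D (indicator ∘ realises t ∘ (suc d ∷_))
    c≟c : ⌊ c Finₚ.≟ c ⌋ ≡ true
    c≟c with c Finₚ.≟ c
    ... | yes _  = refl
    ... | no c≢c = contradiction refl c≢c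

weight : ∀ {q D} → ℕ → Word q D → ℕ
weight p []          = 1
weight p (zero  ∷ w) = p * weight p w
weight p (suc _ ∷ w) = weight p w

-- The sum factors by position: a skip contributes `p`, and each of the `q` letters contributes 1.
sumWords-weight : ∀ q D p → sumWords {q} D (weight p) ≡ (p + q) ^ D
sumWords-weight q zero    p = refl
sumWords-weight q (suc D) p = begin
  sumWords D (λ w → p * weight p w) + sum {q} (λ _ → sumWords D (weight p))
    ≡⟨ cong₂ _+_ (sumWords-* D p (weight p)) (sum-const q _) ⟩
  p * sumWords {q} D (weight p) + q * sumWords {q} D (weight p)
    ≡⟨ *-distribʳ-+ (sumWords {q} D (weight p)) p q ⟨
  (p + q) * sumWords {q} D (weight p)
    ≡⟨ cong ((p + q) *_) (sumWords-weight q D p) ⟩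
  (p + q) * (p + q) ^ D ∎
  where open ≡-Reasoning

-- A subtraction-free way to say that the weight is `p` to the number of skips.
weight-letters : ∀ {q D} p (w : Word q D) → weight p w * p ^ length (letters w) ≡ p ^ D
weight-letters p []          = refl
weight-letters p (zero  ∷ w) = trans (*-assoc p _ _) (cong (p *_) (weight-letters p w))
weight-letters p (suc c ∷ w) = trans (rearrange (weight p w) p _) (cong (p *_) (weight-letters p w))
  where
  rearrange : ∀ a b c → a * (b * c) ≡ b * (a * c)
  rearrange = solve-∀

^-distribʳ-* : ∀ n a b → (a * b) ^ n ≡ a ^ n * b ^ n
^-distribʳ-* zero    a b = refl
^-distribʳ-* (suc n) a b = trans (cong (a * b *_) (^-distribʳ-* n a b)) (rearrange a b (a ^ n) (b ^ n))
  where
  rearrange : ∀ a b c d → a * b * (c * d) ≡ a * c * (b * d)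
  rearrange = solve-∀

-- With letters weighted by 1 and skips by p = 2q, the words with fewer than t letters
-- carry too little weight to account for 2 ^ D realised words, because 2 · 27 < 64.
long-word : ∀ {q t e xs} {R : Fin q → A → A → Set} → 1 ≤ q → (2 * q) ^ t ≤ 2 ^ e →
            (τ : Tree R (3 * e) xs) → ∃ λ w → T (realises τ w) × t ≤ length (letters w)
long-word {q = q@(suc _)} {t} {e} {R = R} 1≤q p^t≤2^e τ with sumWords-pigeonhole D F G ΣG<ΣF
  where
  open ≤-Reasoning
  D = 3 * e
  p = 2 * q
  F G : Word q D → ℕ
  -- `G w < F w` forces both conclusions: an unrealised word has `F w` zero, and fewer than `t`
  -- letters would give `p ^ suc D ≤ p ^ t * weight p w` by `weight-letters`.
  F w = p ^ suc D * indicator (realises τ w)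
  G w = p ^ t * weight p w
  1<p : 1 < p
  1<p = *-monoʳ-≤ 2 1≤q
  54≤64 : 2 ^ e * 3 ^ D ≤ 2 ^ D * 2 ^ D
  54≤64 = begin
    2 ^ e * 3 ^ D          ≡⟨ cong (2 ^ e *_) (^-*-assoc 3 3 e) ⟨
    2 ^ e * 27 ^ e         ≡⟨ ^-distribʳ-* e 2 27 ⟨
    54 ^ e                 ≤⟨ ^-monoˡ-≤ e (m≤m+n 54 10) ⟩
    64 ^ e                 ≡⟨ ^-distribʳ-* e 8 8 ⟩
    8 ^ e * 8 ^ e          ≡⟨ cong₂ _*_ (^-*-assoc 2 3 e) (^-*-assoc 2 3 e) ⟩
    2 ^ D * 2 ^ D          ∎
  3q : ∀ q → 2 * q + q ≡ 3 * q
  3q = solve-∀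
  assoc₁ : ∀ a b c → a * (b * c) ≡ a * b * c
  assoc₁ = solve-∀
  assoc₂ : ∀ a b p → a * a * b * p ≡ p * (a * b) * a
  assoc₂ = solve-∀
  instance
    nz : NonZero (2 ^ D)
    nz = m^n≢0 2 D
    nz′ : NonZero (q ^ D)
    nz′ = m^n≢0 q D
  ΣG<ΣF : sumWords D G < sumWords D F
  ΣG<ΣF = begin-strict
    sumWords D G                            ≡⟨ sumWords-* D (p ^ t) (weight p) ⟩
    p ^ t * sumWords {q} D (weight p)       ≡⟨ cong (p ^ t *_) (sumWords-weight q D p) ⟩
    p ^ t * (p + q) ^ D                     ≡⟨ cong (λ z → p ^ t * z ^ D) (3q q) ⟩
    p ^ t * (3 * q) ^ D                     ≡⟨ cong (p ^ t *_) (^-distribʳ-* D 3 q) ⟩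
    p ^ t * (3 ^ D * q ^ D)                 ≤⟨ *-monoˡ-≤ _ p^t≤2^e ⟩
    2 ^ e * (3 ^ D * q ^ D)                 ≡⟨ assoc₁ (2 ^ e) (3 ^ D) (q ^ D) ⟩
    2 ^ e * 3 ^ D * q ^ D                   ≤⟨ *-monoˡ-≤ (q ^ D) 54≤64 ⟩
    2 ^ D * 2 ^ D * q ^ D                   <⟨ m<m*n _ p {{m*n≢0 (2 ^ D * 2 ^ D) (q ^ D) {{m*n≢0 (2 ^ D) (2 ^ D)}}}} 1<p ⟩
    2 ^ D * 2 ^ D * q ^ D * p               ≡⟨ assoc₂ (2 ^ D) (q ^ D) p ⟩
    p * (2 ^ D * q ^ D) * 2 ^ D             ≡⟨ cong (λ z → p * z * 2 ^ D) (^-distribʳ-* D 2 q) ⟨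
    p ^ suc D * 2 ^ D                       ≤⟨ *-monoʳ-≤ (p ^ suc D) (realised-words τ) ⟩
    p ^ suc D * sumWords D (indicator ∘ realises τ) ≡⟨ sumWords-* D (p ^ suc D) _ ⟨
    sumWords D F                            ∎
... | w , G<F with realises τ w in eq
...   | false = contradiction (subst ((2 * q) ^ t * weight (2 * q) w <_) (*-zeroʳ ((2 * q) ^ suc (3 * e))) G<F) λ ()
...   | true  = w , subst T (sym eq) _ , ≮⇒≥ λ len<t → <⇒≱ G<F (begin
    p ^ suc D * 1                                 ≡⟨ *-identityʳ _ ⟩
    p * p ^ D                                     ≡⟨ cong (p *_) (weight-letters p w) ⟨
    p * (weight p w * p ^ length (letters w))     ≡⟨ rearrange p (weight p w) _ ⟩
    p ^ suc (length (letters w)) * weight p w     ≤⟨ *-monoˡ-≤ (weight p w) (^-monoʳ-≤ p len<t) ⟩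
    p ^ t * weight p w                            ∎)
    where
    open ≤-Reasoning
    D = 3 * e
    p = 2 * q
    rearrange : ∀ a b c → a * (b * c) ≡ a * c * b
    rearrange = solve-∀

-- Leaves of the subtree on selected levels.

T-∧⁻ : ∀ x {y} → T (x ∧ y) → T x × T y
T-∧⁻ true y = _ , y

-- Two leaves are compared at the selected level where their paths part, so it is enough that every
-- colour in `I` implies `S`. A selected letter joins the leaves of both subtrees and doubles their
-- number.
extract : ∀ {q D xs I} {R : Fin q → A → A → Set} {S : A → A → Set}
          (τ : Tree R D xs) w → T (realises τ w) → I ⊑ letters w →
          All (λ c → ∀ {x y} → R c x y → S x y) I →
          ∃ λ ys → length ys ≡ 2 ^ length I × AllPairs S ys × ys ⊆ xs
extract (leaf x x∈) [] _ [] [] = x ∷ [] , refl , [] ∷ [] , λ { (here refl) → x∈ }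
extract (node c sep l⊆ r⊆ l r) (zero ∷ w) real I⊑ RS with realises l w in eq
... | true  with extract l w (subst T (sym eq) _) I⊑ RS
...   | ys , len , ps , ys⊆ = ys , len , ps , l⊆ ∘ ys⊆
extract (node c sep l⊆ r⊆ l r) (zero ∷ w) real I⊑ RS | false with extract r w real I⊑ RS
...   | ys , len , ps , ys⊆ = ys , len , ps , r⊆ ∘ ys⊆
extract (node c sep l⊆ r⊆ l r) (suc d ∷ w) real I⊑ RS
  with T-∧⁻ ⌊ c Finₚ.≟ d ⌋ real
... | c≟d , real′ with T-∧⁻ (realises l w) real′
-- A letter outside the selection acts as a skip: both children realise `w`, and the left one is
-- taken.
extract (node c sep l⊆ r⊆ l r) (suc d ∷ w) real (_ ∷ʳ I⊑) RS | c≟d , _ | reall , realr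
    with extract l w reall I⊑ RS
... | ys , len , ps , ys⊆ = ys , len , ps , l⊆ ∘ ys⊆
extract {I = _ ∷ I} (node c sep l⊆ r⊆ l r) (suc d ∷ w) real (refl ∷ I⊑) (RcS ∷ RS) | c≟d , _ | reall , realr
    with toWitness {a? = c Finₚ.≟ d} c≟d | extract l w reall I⊑ RS | extract r w realr I⊑ RS
... | refl | ys , |ys| , pys , ys⊆ | zs , |zs| , pzs , zs⊆ =
  ys ++ zs ,
  trans (length-++ ys) (trans (cong₂ _+_ |ys| |zs|) (cong (2 ^ length I +_) (sym (+-identityʳ _)))) ,
  AllPairsₚ.++⁺ pys pzs (All.tabulate λ x∈ → All.tabulate λ y∈ → RcS (sep (ys⊆ x∈) (zs⊆ y∈))) ,
  Sum.[ l⊆ ∘ ys⊆ , r⊆ ∘ zs⊆ ]′ ∘ ∈-++⁻ ys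

-- Estimates for binomial coefficients.

2*⌈n/2⌉-bounds : ∀ n → n ≤ 2 * ⌈ n /2⌉ × 2 * ⌈ n /2⌉ ≤ suc n
2*⌈n/2⌉-bounds n =
  (begin
    n                      ≡⟨ ⌊n/2⌋+⌈n/2⌉≡n n ⟨
    ⌊ n /2⌋ + ⌈ n /2⌉      ≤⟨ +-mono-≤ (⌊n/2⌋≤⌈n/2⌉ n) (≤-reflexive (sym (+-identityʳ _))) ⟩
    2 * ⌈ n /2⌉            ∎) ,
  (begin
    2 * ⌈ n /2⌉            ≤⟨ +-monoʳ-≤ ⌈ n /2⌉ (≤-trans (≤-reflexive (+-identityʳ _)) (⌊n/2⌋≤⌈n/2⌉ (suc n))) ⟩
    ⌊ suc n /2⌋ + ⌈ suc n /2⌉ ≡⟨ ⌊n/2⌋+⌈n/2⌉≡n (suc n) ⟩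
    suc n                  ∎)
  where open ≤-Reasoning

C-monoˡ-≤ : ∀ k {m n} → m ≤ n → m C k ≤ n C k
C-monoˡ-≤ zero    m≤n = ≤-refl
C-monoˡ-≤ (suc k) {zero}  m≤n = z≤n
C-monoˡ-≤ (suc k) {suc m} {suc n} (s≤s m≤n) = begin
  suc m C suc k        ≡⟨ nCk+nC[k+1]≡[n+1]C[k+1] m k ⟨
  m C k + m C suc k    ≤⟨ +-mono-≤ (C-monoˡ-≤ k m≤n) (C-monoˡ-≤ (suc k) m≤n) ⟩
  n C k + n C suc k    ≡⟨ nCk+nC[k+1]≡[n+1]C[k+1] n k ⟩
  suc n C suc k        ∎
  where open ≤-Reasoning

-- Absorption without subtraction, which lets Pascal's rule drive the induction.
C-absorption-+ : ∀ n k → suc k * (n C suc k) + k * (n C k) ≡ n * (n C k)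
C-absorption-+ zero zero    = refl
C-absorption-+ zero (suc k) = cong₂ _+_ (*-zeroʳ k) (*-zeroʳ k)
C-absorption-+ (suc n) zero = begin
  1 * (suc n C 1) + 0            ≡⟨ cong (λ z → 1 * z + 0) (nCk+nC[k+1]≡[n+1]C[k+1] n 0) ⟨
  1 * (1 + n C 1) + 0            ≡⟨ rearrange (n C 1) ⟩
  1 + (1 * (n C 1) + 0 * (n C 0)) ≡⟨ cong suc (C-absorption-+ n 0) ⟩
  suc n * 1                      ∎
  where
  open ≡-Reasoning
  rearrange : ∀ c → 1 * (1 + c) + 0 ≡ 1 + (1 * c + 0)
  rearrange = solve-∀
C-absorption-+ (suc n) (suc k) = begin
  suc (suc k) * (suc n C suc (suc k)) + suc k * (suc n C suc k)
    ≡⟨ cong₂ (λ y z → suc (suc k) * y + suc k * z)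
         (nCk+nC[k+1]≡[n+1]C[k+1] n (suc k)) (nCk+nC[k+1]≡[n+1]C[k+1] n k) ⟨
  suc (suc k) * (c₁ + c₂) + suc k * (c₀ + c₁)
    ≡⟨ rearrange k c₀ c₁ c₂ ⟩
  (suc (suc k) * c₂ + suc k * c₁) + (suc k * c₁ + k * c₀) + (c₀ + c₁)
    ≡⟨ cong₂ (λ y z → y + z + (c₀ + c₁)) (C-absorption-+ n (suc k)) (C-absorption-+ n k) ⟩
  n * c₁ + n * c₀ + (c₀ + c₁)
    ≡⟨ rearrange′ n c₀ c₁ ⟩
  suc n * (c₀ + c₁)
    ≡⟨ cong (suc n *_) (nCk+nC[k+1]≡[n+1]C[k+1] n k) ⟩
  suc n * (suc n C suc k) ∎
  where
  open ≡-Reasoning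
  c₀ = n C k
  c₁ = n C suc k
  c₂ = n C suc (suc k)
  rearrange : ∀ k c₀ c₁ c₂ → (2 + k) * (c₁ + c₂) + (1 + k) * (c₀ + c₁)
                           ≡ ((2 + k) * c₂ + (1 + k) * c₁) + ((1 + k) * c₁ + k * c₀) + (c₀ + c₁)
  rearrange = solve-∀
  rearrange′ : ∀ n c₀ c₁ → n * c₁ + n * c₀ + (c₀ + c₁) ≡ (1 + n) * (c₀ + c₁)
  rearrange′ = solve-∀

C-absorption : ∀ n k → suc k * (n C suc k) ≡ (n ∸ k) * (n C k)
C-absorption n k = begin
  suc k * (n C suc k)                               ≡⟨ m+n∸n≡m _ (k * (n C k)) ⟨
  suc k * (n C suc k) + k * (n C k) ∸ k * (n C k)   ≡⟨ cong (_∸ k * (n C k)) (C-absorption-+ n k) ⟩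
  n * (n C k) ∸ k * (n C k)                         ≡⟨ *-distribʳ-∸ (n C k) n k ⟨
  (n ∸ k) * (n C k)                                 ∎
  where open ≡-Reasoning

-- The ratio of (2s C i) to 2 ^ i (s C i) is a product of factors (2s - j) / (2s - 2j);
-- for s ≥ L (L + 1) the factor with index j is at most (2L + 1 - j) / (2L - j), and these telescope.
C-double-step : ∀ L s → L * suc L ≤ s → ∀ i u → i ≤ L → u + i ≡ suc (2 * L) →
                ((2 * s) C i) * u ≤ (s C i) * 2 ^ i * suc (2 * L)
C-double-step L s L²≤s zero u _ u≡ = ≤-reflexive (cong (1 *_) (trans (sym (+-identityʳ u)) u≡))
-- Here `u` is 2L - i. Multiplying by `suc i * suc u` clears the denominators of absorption and of
-- the telescoping factor.
C-double-step L s L²≤s (suc i) u i<L u+i≡ = *-cancelˡ-≤ (suc i * suc u) (begin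
  suc i * suc u * (a′ * u)                  ≡⟨ r₁ (suc i) (suc u) a′ u ⟩
  suc i * a′ * (u * suc u)                  ≡⟨ cong (_* (u * suc u)) (C-absorption (2 * s) i) ⟩
  (2 * s ∸ i) * a * (u * suc u)             ≡⟨ r₂ (2 * s ∸ i) a u (suc u) ⟩
  ((2 * s ∸ i) * u) * (a * suc u)           ≤⟨ *-mono-≤ factor IH ⟩
  2 * (s ∸ i) * suc u * (b * 2 ^ i * suc (2 * L)) ≡⟨ r₃ (s ∸ i) (suc u) b (2 ^ i) (suc (2 * L)) ⟩
  (s ∸ i) * b * (suc u * (2 * 2 ^ i * suc (2 * L))) ≡⟨ cong (_* (suc u * (2 * 2 ^ i * suc (2 * L)))) (C-absorption s i) ⟨
  suc i * b′ * (suc u * (2 * 2 ^ i * suc (2 * L))) ≡⟨ r₄ (suc i) b′ (suc u) (2 * 2 ^ i) (suc (2 * L)) ⟩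
  suc i * suc u * (b′ * 2 ^ suc i * suc (2 * L))   ∎)
  where
  open ≤-Reasoning
  a = (2 * s) C i
  a′ = (2 * s) C suc i
  b = s C i
  b′ = s C suc i
  1+u+i≡ : suc u + i ≡ suc (2 * L)
  1+u+i≡ = trans (sym (+-suc u i)) u+i≡
  IH : a * suc u ≤ b * 2 ^ i * suc (2 * L)
  IH = C-double-step L s L²≤s i (suc u) (<⇒≤ i<L) 1+u+i≡
  i≤s : i ≤ s
  i≤s = ≤-trans (≤-trans (<⇒≤ i<L) (m≤m*n L (suc L))) L²≤s
  split : 2 * s ∸ i ≡ 2 * (s ∸ i) + i
  split = trans (cong (λ z → 2 * z ∸ i) (sym (m∸n+n≡m i≤s)))
         (trans (cong (_∸ i) (r₅ (s ∸ i) i)) (m+n∸n≡m _ i))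
    where
    r₅ : ∀ d i → 2 * (d + i) ≡ 2 * d + i + i
    r₅ = solve-∀
  -- Cross-multiplied form of (2s - i) / (2s - 2i) ≤ (u + 1) / u. Since i ≤ L and u + 2 ≤ 2L + 2,
  -- the product i(u + 2) is at most 2L(L + 1) ≤ 2s.
  i*u≤ : i * u ≤ 2 * (s ∸ i)
  i*u≤ = +-cancelʳ-≤ (2 * i) _ _ (begin
    i * u + 2 * i        ≡⟨ r₆ i u ⟩
    i * suc (suc u)      ≤⟨ *-mono-≤ (<⇒≤ i<L) (s≤s (≤-trans (m≤m+n (suc u) i) (≤-reflexive 1+u+i≡))) ⟩
    L * suc (suc (2 * L)) ≡⟨ r₇ L ⟩
    2 * (L * suc L)      ≤⟨ *-monoʳ-≤ 2 L²≤s ⟩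
    2 * s                ≡⟨ cong (2 *_) (m∸n+n≡m i≤s) ⟨
    2 * (s ∸ i + i)      ≡⟨ *-distribˡ-+ 2 (s ∸ i) i ⟩
    2 * (s ∸ i) + 2 * i  ∎)
    where
    r₆ : ∀ i u → i * u + 2 * i ≡ i * (2 + u)
    r₆ = solve-∀
    r₇ : ∀ L → L * (2 + 2 * L) ≡ 2 * (L * (1 + L))
    r₇ = solve-∀
  factor : (2 * s ∸ i) * u ≤ 2 * (s ∸ i) * suc u
  factor = begin
    (2 * s ∸ i) * u                  ≡⟨ cong (_* u) split ⟩
    (2 * (s ∸ i) + i) * u            ≡⟨ *-distribʳ-+ u (2 * (s ∸ i)) i ⟩
    2 * (s ∸ i) * u + i * u          ≤⟨ +-monoʳ-≤ (2 * (s ∸ i) * u) i*u≤ ⟩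
    2 * (s ∸ i) * u + 2 * (s ∸ i)    ≡⟨ +-comm (2 * (s ∸ i) * u) _ ⟩
    2 * (s ∸ i) + 2 * (s ∸ i) * u    ≡⟨ *-suc (2 * (s ∸ i)) u ⟨
    2 * (s ∸ i) * suc u              ∎
  r₁ : ∀ i v a u → i * v * (a * u) ≡ i * a * (u * v)
  r₁ = solve-∀
  r₂ : ∀ d a u v → d * a * (u * v) ≡ d * u * (a * v)
  r₂ = solve-∀
  r₃ : ∀ d v b p l → 2 * d * v * (b * p * l) ≡ d * b * (v * (2 * p * l))
  r₃ = solve-∀
  r₄ : ∀ i b v p l → i * b * (v * (p * l)) ≡ i * v * (b * p * l)
  r₄ = solve-∀

-- At i = L the telescoped product is (2L + 1) / (L + 1) < 2, which accounts for the extra factor 2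
-- beyond `2 ^ L`.
C-double : ∀ L s → L * suc L ≤ s → (2 * s) C L ≤ (s C L) * 2 ^ suc L
C-double L s L²≤s = *-cancelʳ-≤ _ _ (suc L) (begin
  ((2 * s) C L) * suc L               ≤⟨ C-double-step L s L²≤s L (suc L) ≤-refl (cong (λ z → suc (L + z)) (sym (+-identityʳ L))) ⟩
  (s C L) * 2 ^ L * suc (2 * L)       ≤⟨ *-monoʳ-≤ ((s C L) * 2 ^ L) (n≤1+n _) ⟩
  (s C L) * 2 ^ L * suc (suc (2 * L)) ≡⟨ rearrange (s C L) (2 ^ L) L ⟩
  (s C L) * 2 ^ suc L * suc L         ∎)
  where
  open ≤-Reasoning
  rearrange : ∀ b p L → b * p * (2 + 2 * L) ≡ b * (2 * p) * (1 + L)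
  rearrange = solve-∀

-- Double counting of levels against rows.

module _ {P : A → B → Set} (P? : ∀ c r → Dec (P c r)) where

  hits : List A → B → ℕ
  hits cs r = length (filter (λ c → P? c r) cs)

  -- Counts the pairs of an L-element sublist of cs and an r in rs such that P holds throughout.
  hitSubsets : ℕ → List A → List B → ℕ
  hitSubsets L cs rs = sumᴸ (map (λ r → hits cs r C L) rs)

  -- Pascal's rule inside the sum: a sublist using `c` can be hit only by an `r` that satisfies
  -- `P c r`.
  hitSubsets-∷ : ∀ L c cs rs →
    hitSubsets (suc L) (c ∷ cs) rs ≡ hitSubsets L cs (filter (P? c) rs) + hitSubsets (suc L) cs rs
  hitSubsets-∷ L c cs [] = refl
  hitSubsets-∷ L c cs (r ∷ rs) with does (P? c r)
  ... | true  = trans (cong₂ _+_ (sym (nCk+nC[k+1]≡[n+1]C[k+1] (hits cs r) L)) (hitSubsets-∷ L c cs rs))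
                      (rearrange (hits cs r C L) (hits cs r C suc L)
                        (hitSubsets L cs (filter (P? c) rs)) (hitSubsets (suc L) cs rs))
    where
    rearrange : ∀ a b c d → (a + b) + (c + d) ≡ (a + c) + (b + d)
    rearrange = solve-∀
  ... | false = trans (cong (hits cs r C suc L +_) (hitSubsets-∷ L c cs rs))
                      (rearrange (hits cs r C suc L)
                        (hitSubsets L cs (filter (P? c) rs)) (hitSubsets (suc L) cs rs))
    where
    rearrange : ∀ b c d → b + (c + d) ≡ c + (b + d)
    rearrange = solve-∀

  -- Averaging over L-element sublists, without enumerating them: Pascal's rule splits both sides,
  -- so the sublists with `c` or those without it exceed their share.
  common-hits : ∀ L cs rs n → n * (length cs C L) < hitSubsets L cs rs →
    ∃₂ λ I rs′ → I ⊑ cs × length I ≡ L × rs′ ⊑ rs × n < length rs′ ×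
    All (λ c → All (P c) rs′) I
  common-hits zero cs rs n lt =
    [] , rs , minimum cs , refl , ⊆-refl , subst₂ _<_ (*-identityʳ n) (ones rs) lt , []
    where
    ones : ∀ rs → hitSubsets 0 cs rs ≡ length rs
    ones []       = refl
    ones (_ ∷ rs) = cong suc (ones rs)
  common-hits (suc L) [] rs n lt = contradiction (subst (n * 0 <_) (zeros rs) lt) λ ()
    where
    zeros : ∀ rs → hitSubsets (suc L) [] rs ≡ 0
    zeros []       = refl
    zeros (_ ∷ rs) = zeros rs
  common-hits (suc L) (c ∷ cs) rs n lt
    with n * (length cs C L) <? hitSubsets L cs (filter (P? c) rs)
  ... | yes lt₁ with common-hits L cs (filter (P? c) rs) n lt₁
  ...   | I , rs′ , I⊑ , |I| , rs′⊑ , n< , hit =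
    c ∷ I , rs′ , refl ∷ I⊑ , cong suc |I| , ⊆-trans rs′⊑ (filter-⊆ (P? c) rs) , n< ,
    All-resp-⊆ rs′⊑ (Allₚ.all-filter (P? c) rs) ∷ hit
  common-hits (suc L) (c ∷ cs) rs n lt | no ≮
    with common-hits L′ cs rs n (+-cancelˡ-< (n * (length cs C L)) _ _ (begin-strict
      n * (length cs C L) + n * (length cs C L′) ≡⟨ *-distribˡ-+ n _ _ ⟨
      n * (length cs C L + length cs C L′)       ≡⟨ cong (n *_) (nCk+nC[k+1]≡[n+1]C[k+1] (length cs) L) ⟩
      n * (length (c ∷ cs) C L′)                 <⟨ lt ⟩
      hitSubsets L′ (c ∷ cs) rs ≡⟨ hitSubsets-∷ L c cs rs ⟩
      hitSubsets L cs (filter (P? c) rs) + rest ≤⟨ +-monoˡ-≤ rest (≮⇒≥ ≮) ⟩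
      n * (length cs C L) + rest                 ∎))
    where
    open ≤-Reasoning
    L′ = suc L
    rest = hitSubsets L′ cs rs
  ... | I , rs′ , I⊑ , |I| , rs′⊑ , n< , hit = I , rs′ , c ∷ʳ I⊑ , |I| , rs′⊑ , n< , hit

module _ (σ : A → B → Fin 2) where

  HasSign : Fin 2 → A → B → Set
  HasSign s c r = σ c r ≡ s

  hasSign? : ∀ s c r → Dec (HasSign s c r)
  hasSign? s c r = σ c r Finₚ.≟ s

  signs : Fin 2 → List A → B → ℕ
  signs s = hits (hasSign? s)

  signs-total : ∀ cs r → signs zero cs r + signs (suc zero) cs r ≡ length cs
  signs-total []       r = refl
  signs-total (c ∷ cs) r with σ c r
  ... | zero     = cong suc (signs-total cs r)
  ... | suc zero = trans (+-suc _ _) (cong suc (signs-total cs r))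

  -- If both signs occurred at most s - 1 times, `cs` would have at most 2s - 2 elements. The slack
  -- `suc` admits half the length rounded up as `s`.
  majority-sign : ∀ L s cs r → 2 * s ≤ suc (length cs) →
                  s C L ≤ signs zero cs r C L + signs (suc zero) cs r C L
  majority-sign L s cs r 2s≤ with s ≤? signs zero cs r | s ≤? signs (suc zero) cs r
  ... | yes s≤ | _      = ≤-trans (C-monoˡ-≤ L s≤) (m≤m+n _ _)
  ... | no _   | yes s≤ = ≤-trans (C-monoˡ-≤ L s≤) (m≤n+m _ _)
  ... | no s≰₀ | no s≰₁ = contradiction 2s≤ (<⇒≱ (begin
      suc (suc (length cs))                                      ≡⟨ cong (2 +_) (signs-total cs r) ⟨
      2 + (signs zero cs r + signs (suc zero) cs r)              ≡⟨ cong suc (+-suc _ _) ⟨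
      suc (signs zero cs r) + suc (signs (suc zero) cs r)        ≤⟨ +-mono-≤ (≰⇒> s≰₀) (≰⇒> s≰₁) ⟩
      s + s                                                      ≡⟨ cong (s +_) (+-identityʳ s) ⟨
      2 * s                                                      ∎))
    where open ≤-Reasoning

  sum-majority : ∀ L s cs rs → 2 * s ≤ suc (length cs) → length rs * (s C L) ≤
    hitSubsets (hasSign? zero) L cs rs + hitSubsets (hasSign? (suc zero)) L cs rs
  sum-majority L s cs []       2s≤ = z≤n
  sum-majority L s cs (r ∷ rs) 2s≤ = ≤-trans
    (+-mono-≤ (majority-sign L s cs r 2s≤) (sum-majority L s cs rs 2s≤))
    (≤-reflexive (rearrange (signs zero cs r C L) _ _ _))
    where
    rearrange : ∀ a b c d → (a + b) + (c + d) ≡ (a + c) + (b + d)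
    rearrange = solve-∀

  -- Some sign has more than n times (length cs C L) hits, by comparison with `sum-majority`. Of the
  -- factor `4 * 2 ^ L`, a 2 pays for the two signs and `2 ^ suc L` for `C-double`.
  common-sign : ∀ L n cs rs → 2 * (L * suc L) ≤ length cs → n * (4 * 2 ^ L) < length rs →
    ∃ λ s → ∃₂ λ I rs′ → I ⊑ cs × length I ≡ L × rs′ ⊑ rs × n < length rs′ ×
    All (λ c → All (HasSign s c) rs′) I
  common-sign L n cs rs t≤ n<
    with n * (length cs C L) <? Σ₀ | n * (length cs C L) <? Σ₁
    where
    Σ₀ = hitSubsets (hasSign? zero) L cs rs
    Σ₁ = hitSubsets (hasSign? (suc zero)) L cs rs
  ... | yes lt | _      = zero , common-hits (hasSign? zero) L cs rs n lt
  ... | no _   | yes lt = suc zero , common-hits (hasSign? (suc zero)) L cs rs n lt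
  ... | no ≮₀  | no ≮₁  = contradiction (begin
      length rs * (s C L)                          ≤⟨ sum-majority L s cs rs 2s≤ ⟩
      Σ₀ + Σ₁                                      ≤⟨ +-mono-≤ (≮⇒≥ ≮₀) (≮⇒≥ ≮₁) ⟩
      n * (length cs C L) + n * (length cs C L)    ≡⟨ double (n * (length cs C L)) ⟩
      2 * (n * (length cs C L))                    ≤⟨ *-monoʳ-≤ 2 (*-monoʳ-≤ n (C-monoˡ-≤ L ≤2s)) ⟩
      2 * (n * ((2 * s) C L))                      ≤⟨ *-monoʳ-≤ 2 (*-monoʳ-≤ n (C-double L s L²≤s)) ⟩
      2 * (n * ((s C L) * 2 ^ suc L))                ≡⟨ rearrange n (s C L) (2 ^ L) ⟩
      n * (4 * 2 ^ L) * (s C L)                    ∎) (<⇒≱ (*-monoˡ-< (s C L) {{>-nonZero 0<sCL}} n<))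
    where
    open ≤-Reasoning
    Σ₀ = hitSubsets (hasSign? zero) L cs rs
    Σ₁ = hitSubsets (hasSign? (suc zero)) L cs rs
    s = ⌈ length cs /2⌉
    double : ∀ a → a + a ≡ 2 * a
    double = solve-∀
    rearrange : ∀ n b p → 2 * (n * (b * (2 * p))) ≡ n * (4 * p) * b
    rearrange = solve-∀
    2s≤ = proj₂ (2*⌈n/2⌉-bounds (length cs))
    ≤2s = proj₁ (2*⌈n/2⌉-bounds (length cs))
    L²≤s : L * suc L ≤ s
    L²≤s = *-cancelˡ-≤ 2 (≤-trans t≤ ≤2s)
    0<sCL : 0 < s C L
    0<sCL = ≤-trans (≤-reflexive (sym (nCn≡1 L))) (C-monoˡ-≤ L (≤-trans (m≤m*n L (suc L)) L²≤s))

-- Logarithms, constants and assembly of the submatrix.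

-- Quantified over the accessibility proof so that the induction can follow the recursion of
-- `⌈log2⌉`.
n≤2^⌈log2⌉n : ∀ n rec → n ≤ 2 ^ ⌈log2⌉ n rec
n≤2^⌈log2⌉n zero          _        = z≤n
n≤2^⌈log2⌉n (suc zero)    _        = ≤-refl
n≤2^⌈log2⌉n (suc (suc n)) (acc rs) = begin
  2 + n                          ≤⟨ +-monoʳ-≤ 2 (proj₁ (2*⌈n/2⌉-bounds n)) ⟩
  2 + 2 * ⌈ n /2⌉                ≡⟨ *-suc 2 ⌈ n /2⌉ ⟨
  2 * suc ⌈ n /2⌉                ≤⟨ *-monoʳ-≤ 2 (n≤2^⌈log2⌉n (suc ⌈ n /2⌉) _) ⟩
  2 * 2 ^ ⌈log2⌉ (suc ⌈ n /2⌉) _ ∎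
  where open ≤-Reasoning

2^⌈log₂n⌉≤2*n : ∀ n → 1 ≤ n → 2 ^ ⌈log₂ n ⌉ ≤ 2 * n
2^⌈log₂n⌉≤2*n n 1≤n with ⌈log₂ n ⌉ in eq
... | zero  = ≤-trans 1≤n (m≤m+n n _)
... | suc k = *-monoʳ-≤ 2 {2 ^ k} {n} (≰⇒≥ λ n≤2^k → 1+n≰n (begin
    suc k           ≡⟨ eq ⟨
    ⌈log₂ n ⌉       ≤⟨ ⌈log₂⌉-mono-≤ {n} {2 ^ k} n≤2^k ⟩
    ⌈log₂ 2 ^ k ⌉   ≡⟨ ⌈log₂2^n⌉≡n k ⟩
    k               ∎))
  where open ≤-Reasoning

AllPairs-lookup : {R : A → A → Set} {xs : List A} → AllPairs R xs →
                  ∀ i j → i Fin.< j → R (lookup xs i) (lookup xs j)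
AllPairs-lookup (px ∷ _)  zero    (suc j) _         = All.lookup px (∈-lookup j)
AllPairs-lookup (_ ∷ pxs) (suc i) (suc j) (s≤s i<j) = AllPairs-lookup pxs i j i<j

AllPairs-resp-⊑ : {R : A → A → Set} {xs ys : List A} → xs ⊑ ys → AllPairs R ys → AllPairs R xs
AllPairs-resp-⊑ []         []         = []
AllPairs-resp-⊑ (_ ∷ʳ p)   (_ ∷ pys)  = AllPairs-resp-⊑ p pys
AllPairs-resp-⊑ (refl ∷ p) (py ∷ pys) = All-resp-⊆ p py ∷ AllPairs-resp-⊑ p pys

choose : {R : A → A → Set} {xs : List A} {n : ℕ} → AllPairs R xs → n ≤ length xs →
         Σ (Fin n → A) λ f → (∀ i j → i Fin.< j → R (f i) (f j)) × (∀ i → f i ∈ xs)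
choose {xs = xs} pxs n≤ =
  (λ i → lookup xs (Fin.inject≤ i n≤)) ,
  (λ i j i<j → AllPairs-lookup pxs _ _
     (subst₂ _<_ (sym (Finₚ.toℕ-inject≤ i n≤)) (sym (Finₚ.toℕ-inject≤ j n≤)) i<j)) ,
  λ i → ∈-lookup (Fin.inject≤ i n≤)

signed⇒monotone : ∀ (O : TotalOrder 0ℓ 0ℓ 0ℓ) {m k} (B : Matrix (TotalOrder.Carrier O) m k) s →
                  (∀ r l l′ → l Fin.< l′ → Signed O s (B r l) (B r l′)) → RowMonotone O B
signed⇒monotone O B zero mono = inj₁ increasing
  where
  increasing : RowsIncreasing O B
  increasing r l l′ l≤l′ with l Finₚ.≟ l′
  ... | yes refl = TotalOrder.refl O
  ... | no l≢l′  = mono r l l′ (Finₚ.≤∧≢⇒< l≤l′ l≢l′)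
signed⇒monotone O B (suc zero) mono = inj₂ decreasing
  where
  decreasing : RowsDecreasing O B
  decreasing r l l′ l≤l′ with l Finₚ.≟ l′
  ... | yes refl = TotalOrder.refl O
  ... | no l≢l′  = mono r l l′ (Finₚ.≤∧≢⇒< l≤l′ l≢l′)

-- One factor 1 + 8n² is the cost of a tree level, the other comes from the number of colours in
-- `long-word`. The constant is 972 = 9 · 3 · 9 · 2 · 2, the last 2 from L(L + 1) ≤ 2L².
exponent-bound : ∀ n L → 1 ≤ n →
  (1 + 8 * n ^ 2) * (3 * ((1 + 8 * n ^ 2) * (2 * (L * suc L)))) ≤ 972 * n ^ 4 * L ^ 2
exponent-bound n L 1≤n = begin
  (1 + 8 * n ^ 2) * (3 * ((1 + 8 * n ^ 2) * (2 * (L * suc L))))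
    ≤⟨ *-mono-≤ rows (*-monoʳ-≤ 3 (*-mono-≤ rows (*-monoʳ-≤ 2 (levels L)))) ⟩
  9 * n ^ 2 * (3 * (9 * n ^ 2 * (2 * (2 * L ^ 2))))
    ≡⟨ rearrange 9 3 2 (n ^ 2) (L ^ 2) ⟩
  972 * (n ^ 2 * n ^ 2) * L ^ 2
    ≡⟨ cong (λ k → 972 * k * L ^ 2) (^-distribˡ-+-* n 2 2) ⟨
  972 * n ^ 4 * L ^ 2 ∎
  where
  open ≤-Reasoning
  rows : 1 + 8 * n ^ 2 ≤ 9 * n ^ 2
  rows = +-monoˡ-≤ (8 * n ^ 2) (^-monoˡ-≤ 2 1≤n)
  levels : ∀ L → L * suc L ≤ 2 * L ^ 2
  levels zero    = z≤n
  levels (suc k) = ≤-trans (m≤m+n _ (k * suc k)) (≤-reflexive (square k))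
    where
    square : ∀ k → (1 + k) * (2 + k) + k * (1 + k) ≡ 2 * ((1 + k) * ((1 + k) * 1))
    square = solve-∀
  rearrange : ∀ x y z a b → x * a * (y * (x * a * (z * (z * b)))) ≡ x * y * x * z * z * (a * a) * b
  rearrange = solve-∀

row-monotone-submatrix : (O : TotalOrder 0ℓ 0ℓ 0ℓ) (n L m N : ℕ) → n * (4 * 2 ^ L) < m → n < 2 ^ L →
  2 ^ (suc m * (3 * (suc m * (2 * (L * suc L))))) ≤ N →
  (M : Matrix (TotalOrder.Carrier O) m N) → HasRowMonotoneSubmatrix O (suc n) M
row-monotone-submatrix O n L m N n<m n<2^L 2^≤N M
  with complete-tree O M (3 * (suc m * (2 * (L * suc L)))) 2^≤N
... | _ , τ
  -- `t` is the number of levels that `common-sign` demands; with 2^m colours, (2q)^t is exactly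
  -- 2^((m + 1)t).
  with long-word {t = 2 * (L * suc L)} {e = suc m * (2 * (L * suc L))} (m^n>0 2 m)
         (≤-reflexive (^-*-assoc 2 (suc m) (2 * (L * suc L)))) τ
... | w , real , t≤
  with common-sign finToFun L n (letters w) (allFin m) t≤
         (subst (n * (4 * 2 ^ L) <_) (sym (length-tabulate id)) n<m)
... | s , I , rs , I⊑ , |I| , rs⊑ , n<|rs| , const
  -- `S` keeps only the rows in `rs`, where all colours of `I` carry the sign `s`.
  with extract {R = Pattern O M}
         {S = λ x y → x Fin.< y × (∀ {r} → r ∈ rs → Signed O s (M r x) (M r y))} τ w real I⊑
         (All.map (λ signs {x} {y} (x<y , pattern-xy) → x<y , λ {r} r∈ →
            subst (λ σ → Signed O σ (M r x) (M r y)) (All.lookup signs r∈) (pattern-xy r)) const)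
... | ys , |ys| , pys , _
  with choose pys (≤-trans n<2^L (≤-reflexive (sym (trans |ys| (cong (2 ^_) |I|)))))
     | choose (AllPairs-resp-⊑ rs⊑ (AllPairsₚ.tabulate⁺-< id)) n<|rs|
... | g , g-pairs , _ | f , f-increasing , f∈ =
  f , g , f-increasing , (λ i j → proj₁ ∘ g-pairs i j) ,
  signed⇒monotone O (submatrix M f g) s λ r l l′ l<l′ → proj₂ (g-pairs l l′ l<l′) (f∈ r)

-- The 8 in 8n² is the 4 of `common-sign` times the 2 lost by rounding the logarithm up; n(n + 1) <
-- (n + 1)² gives strictness.
enough-rows : ∀ n p → p ≤ 2 * suc n → n * (4 * p) < 8 * suc n ^ 2
enough-rows n p p≤ = begin-strict
  n * (4 * p)            ≤⟨ *-monoʳ-≤ n (*-monoʳ-≤ 4 p≤) ⟩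
  n * (4 * (2 * suc n))  ≡⟨ rearrange n (suc n) ⟩
  8 * (n * suc n)        <⟨ *-monoʳ-< 8 (*-monoˡ-< (suc n) (n<1+n n)) ⟩
  8 * (suc n * suc n)    ≡⟨ cong (λ k → 8 * (suc n * k)) (*-identityʳ (suc n)) ⟨
  8 * suc n ^ 2          ∎
  where
  open ≤-Reasoning
  rearrange : ∀ a b → a * (4 * (2 * b)) ≡ 8 * (a * b)
  rearrange = solve-∀

theorem2 : Σ ℕ λ c → 1 ≤ c ×
    ((O : TotalOrder 0ℓ 0ℓ 0ℓ) (n N : ℕ) → 1 ≤ n →
    N ≥ 2 ^ (c * n ^ 4 * ⌈log₂ n ⌉ ^ 2) →
    (A : Matrix (TotalOrder.Carrier O) (8 * n ^ 2) N) →
    HasRowMonotoneSubmatrix O n A)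
-- Since ⌈log₂ n⌉ ≤ 2 log₂ n for every n ≥ 1, four times this constant serves for the real
-- logarithm.
theorem2 = 972 , s≤s z≤n , λ { O (suc n) N 1≤n N≥ →
  row-monotone-submatrix O n ⌈log₂ suc n ⌉ (8 * suc n ^ 2) N
    (enough-rows n _ (2^⌈log₂n⌉≤2*n (suc n) 1≤n))
    (n≤2^⌈log2⌉n (suc n) _)
    (≤-trans (^-monoʳ-≤ 2 (exponent-bound (suc n) ⌈log₂ suc n ⌉ 1≤n)) N≥) }
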